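{- Let $\mathcal{V}$ be a strongly irregular variety of a plural type (possibly with constants), let $\mathbf{A}$ be the P\l onka sum over a semilattice direct system $\mathbb{A}=(\{\mathbf{A}_i\}_{i\in I},(I,\le),\{p_{ij}\}_{i\le j})$ of algebras in $\mathcal{V}$, and let $\theta_1,\theta_2\in Con(\mathbf{A})$. Then the following are equivalent: (1) $(\theta_1,\theta_2)$ is a pair of factor congruences on $\mathbf{A}$; (2) $\theta_1,\theta_2$ are permutable, $(C_{\theta_1},C_{\theta_2})$ is a pair of factor congruences on $\mathbf{I}=(I,\le)$, and for every $i\in I$, $((\theta_1)_{ii},(\theta_2)_{ii})$ is a pair of factor congruences on $\mathbf{A}_i$.
   Context: A type is plural if it contains at least one operation symbol of arity at least $2$. A variety $\mathcal{V}$ is strongly irregular if there is a binary term $f(x,y)$, in which both variables actually occur, such that $\mathcal{V}\models f(x,y)\approx x$. A semilattice direct system $\mathbb{A}=(\{\mathbf{A}_i\}_{i\in I},(I,\le),\{p_{ij}\}_{i\le j})$ consists of a join-semilattice $\mathbf{I}=(I,\le)$ with join $\vee$ (required to have a least element $i_0$ when the type contains constants), algebras $\mathbf{A}_i$ of the same type with pairwise disjoint universes, and homomorphisms $p_{ij}\colon\mathbf{A}_i\to\mathbf{A}_j$ for $i\le j$ with $p_{ii}=\mathrm{id}$ and $p_{ik}=p_{jk}\circ p_{ij}$ for $i\le j\le k$. Its P\l onka sum is the algebra with universe $\bigcup_{i\in I}A_i$ in which, for every $n$-ary operation $g$ with $n\ge1$ and $a_1\in A_{i_1},\dots,a_n\in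 A_{i_n}$, $g(a_1,\dots,a_n)=g^{\mathbf{A}_j}(p_{i_1j}(a_1),\dots,p_{i_nj}(a_n))$ with $j=i_1\vee\dots\vee i_n$, and every constant $c$ is interpreted as $c^{\mathbf{A}_{i_0}}$. For $\theta\in Con(\mathbf{A})$: $\theta_{ij}:=\theta\cap(A_i\times A_j)$; $S_\theta:=\{(i,j)\in I\times I\mid\theta_{ij}\neq\emptyset\}$; $C_\theta:=\{(i,j)\in I\times I\mid (i,i\vee j),(j,i\vee j)\in S_\theta\}$, which is a congruence of $\mathbf{I}$. Congruences $\theta_1,\theta_2$ of an algebra are permutable if $\theta_1\circ\theta_2=\theta_2\circ\theta_1$ (relational product). A pair $(\theta_1,\theta_2)$ of congruences of an algebra $\mathbf{B}$ is a pair of factor congruences if $\theta_1\cap\theta_2=\Delta_{\mathbf{B}}$ (identity relation), $\theta_1\vee\theta_2=\nabla_{\mathbf{B}}$ (total relation) and $\theta_1,\theta_2$ are permutable. -}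

module Defs where

open import Data.Fin.Base using (Fin; zero; suc)
open import Data.Nat.Base using (ℕ; zero; suc) renaming (_≤_ to _≤ℕ_)
open import Data.Product.Base using (Σ; ∃; ∃-syntax; Σ-syntax; _×_; _,_; proj₁; proj₂)
open import Data.Unit.Base using (⊤; tt)
open import Data.Vec.Functional using (Vector; head; tail)
open import Level using (Level; _⊔_; 0ℓ) renaming (suc to lsuc)
open import Relation.Binary.Bundles using (Setoid)
open import Relation.Binary.Construct.Composition using (_;_)
open import Relation.Binary.Construct.Intersection using (_∩_)
open import Relation.Binary.Construct.Union using (_∪_)
open import Relation.Binary.Core using (Rel; _⇒_; _⇔_)
open import Relation.Binary.Definitions using (Minimum; Universal)
open import Relation.Binary.Lattice.Bundles using (JoinSemilattice)
import Relation.Binary.Lattice.Properties.JoinSemilattice as JoinSemilatticeProperties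
open import Relation.Binary.PropositionalEquality.Core using (_≡_; refl)
open import Relation.Binary.Structures using (IsEquivalence)

private
  variable
    o e a ℓ b ℓ′ c ℓ₁ ℓ₂ r r₁ r₂ : Level

record Signature (o : Level) : Set (lsuc o) where
  field
    Op    : Set o
    arity : Op → ℕ

open Signature public

HasConstants : Signature o → Set o
HasConstants Ω = ∃[ g ] arity Ω g ≡ 0

Plural : Signature o → Set o
Plural Ω = ∃[ g ] 2 ≤ℕ arity Ω g

-- Universes are nonempty, as usual in universal algebra; without this,
-- the relation C below need not be reflexive.
record Algebra (Ω : Signature o) (a ℓ : Level) : Set (o ⊔ lsuc (a ⊔ ℓ)) where
  infix 4 _≈_
  field
    Carrier       : Set a
    _≈_           : Rel Carrier ℓ
    isEquivalence : IsEquivalence _≈_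
    op            : (g : Op Ω) → Vector Carrier (arity Ω g) → Carrier
    op-cong       : ∀ g {xs ys} → (∀ k → xs k ≈ ys k) → op g xs ≈ op g ys
    nonempty      : Carrier

  open IsEquivalence isEquivalence public
    renaming (refl to ≈-refl; sym to ≈-sym; trans to ≈-trans; reflexive to ≈-reflexive)

record IsHomomorphism {Ω : Signature o} (A : Algebra Ω a ℓ) (B : Algebra Ω b ℓ′)
                      (f : Algebra.Carrier A → Algebra.Carrier B)
                      : Set (o ⊔ a ⊔ ℓ ⊔ ℓ′) where
  private
    module A = Algebra A
    module B = Algebra B
  field
    cong : ∀ {x y} → x A.≈ y → f x B.≈ f y
    homo : ∀ g xs → f (A.op g xs) B.≈ B.op g (λ k → f (xs k))

data Term (Ω : Signature o) (X : Set) : Set o where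
  var  : X → Term Ω X
  node : (g : Op Ω) → Vector (Term Ω X) (arity Ω g) → Term Ω X

data _OccursIn_ {Ω : Signature o} {X : Set} (x : X) : Term Ω X → Set o where
  here  : x OccursIn var x
  there : ∀ {g ts} (k : Fin (arity Ω g)) → x OccursIn ts k → x OccursIn node g ts

module _ {Ω : Signature o} (A : Algebra Ω a ℓ) where
  open Algebra A

  ⟦_⟧ : {X : Set} → Term Ω X → (X → Carrier) → Carrier
  ⟦ var x     ⟧ ρ = ρ x
  ⟦ node g ts ⟧ ρ = op g (λ k → ⟦ ts k ⟧ ρ)

  Satisfies : {X : Set} → Term Ω X → Term Ω X → Set (a ⊔ ℓ)
  Satisfies s t = ∀ ρ → ⟦ s ⟧ ρ ≈ ⟦ t ⟧ ρ

-- A variety is given by a set of identities in countably many variables.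
Variety : Signature o → (e : Level) → Set (o ⊔ lsuc e)
Variety Ω e = Rel (Term Ω ℕ) e

infix 4 _∈_

_∈_ : {Ω : Signature o} → Algebra Ω a ℓ → Variety Ω e → Set _
A ∈ 𝒱 = ∀ {s t} → 𝒱 s t → Satisfies A s t

-- Validity in every member of the variety at universe levels a and ℓ.
ValidIn : {Ω : Signature o} {X : Set} → Variety Ω e → (a ℓ : Level) →
          Term Ω X → Term Ω X → Set _
ValidIn {Ω = Ω} 𝒱 a ℓ s t = (A : Algebra Ω a ℓ) → A ∈ 𝒱 → Satisfies A s t

StronglyIrregular : {Ω : Signature o} → Variety Ω e → (a ℓ : Level) → Set _
StronglyIrregular {Ω = Ω} 𝒱 a ℓ =
  Σ[ f ∈ Term Ω (Fin 2) ]
    zero OccursIn f × suc zero OccursIn f × ValidIn 𝒱 a ℓ f (var zero)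

module _ {Ω : Signature o} (B : Algebra Ω b ℓ) where
  open Algebra B

  record IsCongruence (θ : Rel Carrier r) : Set (o ⊔ b ⊔ ℓ ⊔ r) where
    field
      reflexive     : _≈_ ⇒ θ
      isEquivalence : IsEquivalence θ
      compatible    : ∀ g {xs ys} → (∀ k → θ (xs k) (ys k)) → θ (op g xs) (op g ys)

  data Cg (R : Rel Carrier r) : Rel Carrier (o ⊔ b ⊔ ℓ ⊔ r) where
    base       : ∀ {x y} → R x y → Cg R x y
    reflexive  : ∀ {x y} → x ≈ y → Cg R x y
    symmetric  : ∀ {x y} → Cg R x y → Cg R y x
    transitive : ∀ {x y z} → Cg R x y → Cg R y z → Cg R x z
    compatible : ∀ g {xs ys} → (∀ k → Cg R (xs k) (ys k)) → Cg R (op g xs) (op g ys)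

  -- The join in the lattice of congruences of B.
  Join : Rel Carrier r₁ → Rel Carrier r₂ → Rel Carrier _
  Join θ φ = Cg (θ ∪ φ)

  Permutable : Rel Carrier r₁ → Rel Carrier r₂ → Set _
  Permutable θ φ = (θ ; φ) ⇔ (φ ; θ)

  record IsFactorPair (θ : Rel Carrier r₁) (φ : Rel Carrier r₂)
                      : Set (o ⊔ b ⊔ ℓ ⊔ r₁ ⊔ r₂) where
    field
      isCongruence₁ : IsCongruence θ
      isCongruence₂ : IsCongruence φ
      meet          : (θ ∩ φ) ⇔ _≈_
      join          : Universal (Join θ φ)
      permutable    : Permutable θ φ

semilatticeSignature : Signature 0ℓ
semilatticeSignature = record { Op = ⊤ ; arity = λ _ → 2 }

semilatticeAlgebra : (I : JoinSemilattice c ℓ₁ ℓ₂) → JoinSemilattice.Carrier I →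
                     Algebra semilatticeSignature c ℓ₁
semilatticeAlgebra I i = record
  { Carrier       = Carrier
  ; _≈_           = _≈_
  ; isEquivalence = isEquivalence
  ; op            = λ _ xs → xs zero ∨ xs (suc zero)
  ; op-cong       = λ _ eq → ∨-cong (eq zero) (eq (suc zero))
  ; nonempty      = i
  }
  where
  open JoinSemilattice I
  open JoinSemilatticeProperties I using (∨-cong)

-- The maps p take a proof of i ≤ j, and their laws are required for all
-- such proofs; hence p depends only on i and j, and i ≈ j makes p an
-- isomorphism.
record DirectSystem (Ω : Signature o) (c ℓ₁ ℓ₂ a ℓ : Level)
                    : Set (o ⊔ lsuc (c ⊔ ℓ₁ ⊔ ℓ₂ ⊔ a ⊔ ℓ)) where
  field
    semilattice : JoinSemilattice c ℓ₁ ℓ₂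

  module I = JoinSemilattice semilattice
  open I using (_≤_)

  field
    index₀  : I.Carrier
    least   : HasConstants Ω → ∃[ i₀ ] Minimum _≤_ i₀
    algebra : I.Carrier → Algebra Ω a ℓ

  module A (i : I.Carrier) = Algebra (algebra i)

  field
    p      : ∀ {i j} → i ≤ j → A.Carrier i → A.Carrier j
    p-homo : ∀ {i j} (i≤j : i ≤ j) → IsHomomorphism (algebra i) (algebra j) (p i≤j)
    p-id   : ∀ {i} (i≤i : i ≤ i) x → A._≈_ i (p i≤i x) x
    p-comp : ∀ {i j k} (i≤j : i ≤ j) (j≤k : j ≤ k) (i≤k : i ≤ k) x →
             A._≈_ k (p i≤k x) (p j≤k (p i≤j x))

  indexAlgebra : Algebra semilatticeSignature c ℓ₁
  indexAlgebra = semilatticeAlgebra semilattice index₀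

module _ {Ω : Signature o} (𝔸 : DirectSystem Ω c ℓ₁ ℓ₂ a ℓ) where
  open DirectSystem 𝔸
  open I using (_≤_; _∨_; x≤x∨y; y≤x∨y)
  open JoinSemilatticeProperties semilattice using (∨-cong)

  ⋁⁺ : ∀ {n} → Vector I.Carrier (suc n) → I.Carrier
  ⋁⁺ {zero}  is = head is
  ⋁⁺ {suc n} is = head is ∨ ⋁⁺ (tail is)

  -- The first argument supplies the index used for the empty join.
  ⋁ : ∀ {n} → (n ≡ 0 → I.Carrier) → Vector I.Carrier n → I.Carrier
  ⋁ {zero}  i₀ is = i₀ refl
  ⋁ {suc n} i₀ is = ⋁⁺ is

  private
    ⋁⁺-upper : ∀ {n} (is : Vector I.Carrier (suc n)) k → is k ≤ ⋁⁺ is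
    ⋁⁺-upper {zero}  is zero    = I.refl
    ⋁⁺-upper {suc n} is zero    = x≤x∨y _ _
    ⋁⁺-upper {suc n} is (suc k) = I.trans (⋁⁺-upper (tail is) k) (y≤x∨y _ _)

    ⋁⁺-cong : ∀ {n} {is js : Vector I.Carrier (suc n)} →
              (∀ k → is k I.≈ js k) → ⋁⁺ is I.≈ ⋁⁺ js
    ⋁⁺-cong {zero}  eq = eq zero
    ⋁⁺-cong {suc n} eq = ∨-cong (eq zero) (⋁⁺-cong (λ k → eq (suc k)))

  ⋁-upper : ∀ {n} (i₀ : n ≡ 0 → I.Carrier) (is : Vector I.Carrier n) k → is k ≤ ⋁ i₀ is
  ⋁-upper {suc n} i₀ is k = ⋁⁺-upper is k

  ⋁-cong : ∀ {n} (i₀ : n ≡ 0 → I.Carrier) {is js : Vector I.Carrier n} →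
           (∀ k → is k I.≈ js k) → ⋁ i₀ is I.≈ ⋁ i₀ js
  ⋁-cong {zero}  i₀ eq = I.Eq.refl
  ⋁-cong {suc n} i₀ eq = ⋁⁺-cong eq

  PłonkaCarrier : Set (c ⊔ a)
  PłonkaCarrier = Σ[ i ∈ I.Carrier ] A.Carrier i

  -- Equality in the disjoint union: equal indices and, identifying the
  -- algebras at equal indices by means of p, equal elements.
  _≈ᴾ_ : Rel PłonkaCarrier (ℓ₁ ⊔ ℓ)
  (i , x) ≈ᴾ (j , y) = Σ[ i≈j ∈ i I.≈ j ] A._≈_ j (p (I.reflexive i≈j) x) y

  outputIndex : (g : Op Ω) → Vector PłonkaCarrier (arity Ω g) → I.Carrier
  outputIndex g xs = ⋁ (λ nullary → proj₁ (least (g , nullary))) (λ k → proj₁ (xs k))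

  ≤-outputIndex : ∀ g xs k → proj₁ (xs k) ≤ outputIndex g xs
  ≤-outputIndex g xs k = ⋁-upper _ (λ k → proj₁ (xs k)) k

  opᴾ : (g : Op Ω) → Vector PłonkaCarrier (arity Ω g) → PłonkaCarrier
  opᴾ g xs = outputIndex g xs
           , A.op (outputIndex g xs) g (λ k → p (≤-outputIndex g xs k) (proj₂ (xs k)))

  private
    p-cong : ∀ {i j} (u : i ≤ j) {x y} → A._≈_ i x y → A._≈_ j (p u x) (p u y)
    p-cong u = IsHomomorphism.cong (p-homo u)

    p-coherent : ∀ {i j j′ k} (u : i ≤ j) (v : j ≤ k) (u′ : i ≤ j′) (v′ : j′ ≤ k) x →
                 A._≈_ k (p v (p u x)) (p v′ (p u′ x))
    p-coherent {k = k} u v u′ v′ x =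
      A.≈-trans k (A.≈-sym k (p-comp u v w x)) (p-comp u′ v′ w x)
      where w = I.trans u v

    ≈ᴾ-isEquivalence : IsEquivalence _≈ᴾ_
    ≈ᴾ-isEquivalence = record
      { refl  = I.Eq.refl , p-id _ _
      ; sym   = λ { {i , x} {j , y} (e , q) →
                  I.Eq.sym e
                , A.≈-trans i (p-cong _ (A.≈-sym j q))
                    (A.≈-trans i (A.≈-sym i (p-comp _ _ I.refl x)) (p-id _ x)) }
      ; trans = λ { {i , x} {j , y} {k , z} (e , q) (e′ , q′) →
                  I.Eq.trans e e′
                , A.≈-trans k (p-comp _ (I.reflexive e′) _ x) (A.≈-trans k (p-cong _ q) q′) }
      }

    opᴾ-cong : ∀ g {xs ys} → (∀ k → xs k ≈ᴾ ys k) → opᴾ g xs ≈ᴾ opᴾ g ys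
    opᴾ-cong g {xs} {ys} eq = i≈j , A.≈-trans j
        (IsHomomorphism.homo (p-homo (I.reflexive i≈j)) g _)
        (A.op-cong j g (λ k → A.≈-trans j
          (p-coherent (≤-outputIndex g xs k) _ (I.reflexive (proj₁ (eq k))) (≤-outputIndex g ys k) _)
          (p-cong _ (proj₂ (eq k)))))
      where
      j = outputIndex g ys
      i≈j : outputIndex g xs I.≈ j
      i≈j = ⋁-cong _ (λ k → proj₁ (eq k))

  PłonkaSum : Algebra Ω (c ⊔ a) (ℓ₁ ⊔ ℓ)
  PłonkaSum = record
    { Carrier       = PłonkaCarrier
    ; _≈_           = _≈ᴾ_
    ; isEquivalence = ≈ᴾ-isEquivalence
    ; op            = opᴾ
    ; op-cong       = opᴾ-cong
    ; nonempty      = index₀ , A.nonempty index₀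
    }

  Restrict : Rel PłonkaCarrier r → ∀ i j → A.Carrier i → A.Carrier j → Set r
  Restrict θ i j x y = θ (i , x) (j , y)

  S : Rel PłonkaCarrier r → Rel I.Carrier (a ⊔ r)
  S θ i j = ∃[ x ] ∃[ y ] Restrict θ i j x y

  C : Rel PłonkaCarrier r → Rel I.Carrier (a ⊔ r)
  C θ i j = S θ i (i ∨ j) × S θ j (i ∨ j)

{-# OPTIONS --safe #-}
-- If f(x,y) ≈ x is the strongly irregular identity, then in the Płonka sum
-- f(a,b) is the image of a in the component indexed by the join of the indices
-- of a and b.  Hence every congruence θ is compatible with the maps p, and
-- "θ relates A i to A (i ∨ j)" is a join-compatible preorder on I, whose
-- symmetric part is C θ.  If θ₁ ∩ θ₂ is trivial, then indices related by both
-- S θ₁ and S θ₂ coincide, so intermediate elements of compositions in the Płonka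
-- sum can be moved into the components.
module Submission where

open import Defs
open import Data.Fin.Base using (Fin; zero; suc)
open import Data.Nat.Base using (zero; suc)
open import Data.Product.Base using (_×_; _,_; proj₁; proj₂)
open import Data.Sum.Base using (inj₁; inj₂)
open import Data.Vec.Functional using (Vector; head; tail; _∷_; [])
open import Function.Bundles using (_⇔_; mk⇔)
open import Level using (Level)
open import Relation.Binary.Construct.Composition using (_;_)
open import Relation.Binary.Core using (Rel)
open import Relation.Binary.Definitions using (Universal)
open import Relation.Binary.PropositionalEquality.Core using (_≡_)
open import Relation.Binary.Structures using (IsEquivalence)

private
  variable
    o c ℓ₁ ℓ₂ a b ℓ r r₁ r₂ : Level

module CongruenceLaws {Ω : Signature o} {B : Algebra Ω b ℓ} {θ : Rel (Algebra.Carrier B) r}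
                      (θ-cong : IsCongruence B θ) where
  open IsCongruence θ-cong public
  open IsEquivalence isEquivalence public using (refl; sym; trans)

-- Factor pairs and relational composition.

module _ {Ω : Signature o} {B : Algebra Ω b ℓ} where
  open Algebra B using (Carrier; _≈_)

  module _ {θ : Rel Carrier r₁} {φ : Rel Carrier r₂}
           (θ-cong : IsCongruence B θ) (φ-cong : IsCongruence B φ) where
    private
      module θ = CongruenceLaws θ-cong
      module φ = CongruenceLaws φ-cong

    -- When `θ` and `φ` permute, `θ ; φ` is itself a congruence containing both. Symmetry and
    -- transitivity are the two closure rules that use permutability.
    Join⇒composition : Permutable B θ φ → ∀ {x y} → Join B θ φ x y → (θ ; φ) x y
    Join⇒composition perm (base (inj₁ xθy)) = _ , xθy , φ.refl
    Join⇒composition perm (base (inj₂ xφy)) = _ , θ.refl , xφy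
    Join⇒composition perm (reflexive x≈y)   = _ , θ.reflexive x≈y , φ.refl
    Join⇒composition perm (symmetric q) =
      let z , xθz , zφy = Join⇒composition perm q in proj₂ perm (z , φ.sym zφy , θ.sym xθz)
    Join⇒composition perm (transitive q q′) =
      let u , xθu , uφy = Join⇒composition perm q
          v , yθv , vφz = Join⇒composition perm q′
          w , uθw , wφv = proj₂ perm (_ , uφy , yθv)
      in w , θ.trans xθu uθw , φ.trans wφv vφz
    Join⇒composition perm (compatible g qs) =
      let rs = λ k → Join⇒composition perm (qs k)
      in _ , θ.compatible g (λ k → proj₁ (proj₂ (rs k)))
           , φ.compatible g (λ k → proj₂ (proj₂ (rs k)))

    -- Totality of one composite gives the join; totality of both makes permutability immediate.
    universal⇒IsFactorPair : (∀ {x y} → θ x y → φ x y → x ≈ y) →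
      Universal (θ ; φ) → Universal (φ ; θ) → IsFactorPair B θ φ
    universal⇒IsFactorPair θ∩φ⇒≈ total₁ total₂ = record
      { isCongruence₁ = θ-cong
      ; isCongruence₂ = φ-cong
      ; meet          = (λ (xθy , xφy) → θ∩φ⇒≈ xθy xφy)
                      , λ x≈y → θ.reflexive x≈y , φ.reflexive x≈y
      ; join          = λ x y → let _ , xθz , zφy = total₁ x y in
                          transitive (base (inj₁ xθz)) (base (inj₂ zφy))
      ; permutable    = (λ _ → total₂ _ _) , (λ _ → total₁ _ _)
      }

  module _ {θ : Rel Carrier r₁} {φ : Rel Carrier r₂} (pair : IsFactorPair B θ φ) where
    open IsFactorPair pair

    IsFactorPair⇒universal : Universal (θ ; φ)
    IsFactorPair⇒universal x y =
      Join⇒composition isCongruence₁ isCongruence₂ permutable (join x y)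

    IsFactorPair⇒universal˘ : Universal (φ ; θ)
    IsFactorPair⇒universal˘ x y = proj₁ permutable (IsFactorPair⇒universal x y)

-- Transition maps and term evaluation in the Płonka sum.

module _ {Ω : Signature o} (𝔸 : DirectSystem Ω c ℓ₁ ℓ₂ a ℓ) where
  open DirectSystem 𝔸
  open I using (_≤_; _∨_; x≤x∨y; y≤x∨y; ∨-least)
  private
    P = PłonkaSum 𝔸
    module P = Algebra P

  p-cong : ∀ {i j} (u : i ≤ j) {x y} → A._≈_ i x y → A._≈_ j (p u x) (p u y)
  p-cong u = IsHomomorphism.cong (p-homo u)

  p-irrelevant : ∀ {i j} (u v : i ≤ j) x → A._≈_ j (p u x) (p v x)
  p-irrelevant {j = j} u v x = A.≈-trans j (p-comp v I.refl u x) (p-id I.refl (p v x))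

  -- Antisymmetry supplies the equality of indices, and any proof of `i ≤ j` will do because `p` is
  -- independent of it.
  ≈ᴾ-intro : ∀ {i j x y} (u : i ≤ j) → j ≤ i → A._≈_ j (p u x) y → (i , x) P.≈ (j , y)
  ≈ᴾ-intro {j = j} u v e =
    I.antisym u v , A.≈-trans j (p-irrelevant _ u _) e

  ≈ᴾ-p : ∀ {i j x} (u : i ≤ j) → j ≤ i → (i , x) P.≈ (j , p u x)
  ≈ᴾ-p {j = j} u v = ≈ᴾ-intro u v (A.≈-refl j)

  ≈ᴾ⇒≈ : ∀ {i x y} → (i , x) P.≈ (i , y) → A._≈_ i x y
  ≈ᴾ⇒≈ {i} (_ , e) = A.≈-trans i (A.≈-sym i (p-id _ _)) e

  ⋁⁺-least : ∀ {n} (is : Vector I.Carrier (suc n)) {j} → (∀ k → is k ≤ j) → ⋁⁺ 𝔸 is ≤ j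
  ⋁⁺-least {zero}  is us = us zero
  ⋁⁺-least {suc n} is us = ∨-least (us zero) (⋁⁺-least (tail is) (λ k → us (suc k)))

  ⋁-least : ∀ {n} (i₀ : n ≡ 0 → I.Carrier) (is : Vector I.Carrier n) {j} →
            (∀ e → i₀ e ≤ j) → (∀ k → is k ≤ j) → ⋁ 𝔸 i₀ is ≤ j
  ⋁-least {zero}  i₀ is us₀ us = us₀ _
  ⋁-least {suc n} i₀ is us₀ us = ⋁⁺-least is us

  module _ {X : Set} {ρ : X → PłonkaCarrier 𝔸} where

    OccursIn⇒≤ : ∀ {x t} → x OccursIn t → proj₁ (ρ x) ≤ proj₁ (⟦_⟧ P t ρ)
    OccursIn⇒≤ here = I.refl
    OccursIn⇒≤ {t = node g ts} (there k q) =
      I.trans (OccursIn⇒≤ q) (≤-outputIndex 𝔸 g (λ m → ⟦_⟧ P (ts m) ρ) k)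

    module _ {j} (us : ∀ x → proj₁ (ρ x) ≤ j) where

      ⟦⟧-index-≤ : ∀ t → proj₁ (⟦_⟧ P t ρ) ≤ j
      ⟦⟧-index-≤ (var x)     = us x
      ⟦⟧-index-≤ (node g ts) =
        -- For a nullary `g` the value sits at the least index, which is below `j`.
        ⋁-least _ _ (λ e → proj₂ (least (g , e)) j) (λ k → ⟦⟧-index-≤ (ts k))

      -- Each `p` is a homomorphism and consecutive maps compose, so pushing to `j` may be moved
      -- from the value of a term down to its variables.
      p-⟦⟧ : ∀ t (u : proj₁ (⟦_⟧ P t ρ) ≤ j) →
             A._≈_ j (p u (proj₂ (⟦_⟧ P t ρ)))
                     (⟦_⟧ (algebra j) t (λ x → p (us x) (proj₂ (ρ x))))
      p-⟦⟧ (var x)     u = p-irrelevant _ _ _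
      p-⟦⟧ (node g ts) u = A.≈-trans j (IsHomomorphism.homo (p-homo u) g _)
        (A.op-cong j g λ k → A.≈-trans j
          (A.≈-sym j (p-comp _ u (⟦⟧-index-≤ (ts k)) _))
          (p-⟦⟧ (ts k) _))

  -- Congruences on the sum and the maps `p`.

  module _ {θ : Rel (PłonkaCarrier 𝔸) r} (θ-cong : IsCongruence P θ) where
    private
      module θ = CongruenceLaws θ-cong

    ⟦⟧-compatible : ∀ {X} (t : Term Ω X) {ρ σ} → (∀ x → θ (ρ x) (σ x)) →
                    θ (⟦_⟧ P t ρ) (⟦_⟧ P t σ)
    ⟦⟧-compatible (var x)     h = h x
    ⟦⟧-compatible (node g ts) h = θ.compatible g (λ k → ⟦⟧-compatible (ts k) h)

  module _ (f : Term Ω (Fin 2)) (f∋0 : zero OccursIn f) (f∋1 : suc zero OccursIn f)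
           (f≈0 : ∀ i → Satisfies (algebra i) f (var zero)) where

    ⟦f⟧≈p : ∀ {i j k x y} (u : i ≤ k) → j ≤ k → k ≤ i ∨ j →
            ⟦_⟧ P f ((i , x) ∷ (j , y) ∷ []) P.≈ (k , p u x)
    ⟦f⟧≈p {i} {j} {k} {x} {y} u v w =
      ≈ᴾ-intro (⟦⟧-index-≤ us f)
        (I.trans w (∨-least (OccursIn⇒≤ f∋0) (OccursIn⇒≤ f∋1)))
        (A.≈-trans k (p-⟦⟧ us f _) (f≈0 k _))
      where
      us : ∀ m → proj₁ (((i , x) ∷ (j , y) ∷ []) m) ≤ k
      us zero       = u
      us (suc zero) = v

    module _ {θ : Rel (PłonkaCarrier 𝔸) r} (θ-cong : IsCongruence P θ) where
      private
        module θ = CongruenceLaws θ-cong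

      -- The hypotheses on k and k′ say k ≈ i ∨ j and k′ ≈ i′ ∨ j′.
      p-compatible : ∀ {i i′ j j′ k k′ x x′ y y′} →
        θ (i , x) (i′ , x′) → θ (j , y) (j′ , y′) →
        (u : i ≤ k) → j ≤ k → k ≤ i ∨ j → (u′ : i′ ≤ k′) → j′ ≤ k′ → k′ ≤ i′ ∨ j′ →
        θ (k , p u x) (k′ , p u′ x′)
      p-compatible {i} {i′} {j} {j′} {x = x} {x′} {y} {y′} xθx′ yθy′ u v w u′ v′ w′ =
        θ.trans (θ.reflexive (P.≈-sym (⟦f⟧≈p u v w)))
          (θ.trans (⟦⟧-compatible θ-cong f h) (θ.reflexive (⟦f⟧≈p u′ v′ w′)))
        where
        h : ∀ m → θ (((i , x) ∷ (j , y) ∷ []) m) (((i′ , x′) ∷ (j′ , y′) ∷ []) m)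
        h zero       = xθx′
        h (suc zero) = yθy′

      -- A single related pair suffices: applying `f` with `x` first and that pair second fixes `x`
      -- on one side and moves it to `k` on the other.
      S-absorb : ∀ {i j k} → S 𝔸 θ i j → (u : i ≤ k) → j ≤ k → k ≤ i ∨ j →
                 ∀ x → θ (i , x) (k , p u x)
      S-absorb (_ , _ , s) u v w x =
        θ.trans (θ.reflexive (≈ᴾ-p I.refl I.refl))
          (p-compatible θ.refl s I.refl I.refl (x≤x∨y _ _) u v w)

      -- The preorder on indices induced by a congruence.

      infix 4 _≼_

      -- j ≼ i holds iff the class of j is below that of i in I / C θ.
      _≼_ : Rel I.Carrier _
      j ≼ i = S 𝔸 θ i (i ∨ j)

      ≼-absorb : ∀ {i j} → j ≼ i → ∀ x → θ (i , x) (i ∨ j , p (x≤x∨y i j) x)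
      ≼-absorb s = S-absorb s (x≤x∨y _ _) I.refl (y≤x∨y _ _)

      S⇒≼ : ∀ {i j} → S 𝔸 θ i j → j ≼ i
      S⇒≼ {i} s = A.nonempty i , _ , S-absorb s (x≤x∨y _ _) (y≤x∨y _ _) I.refl _

      ≤⇒≼ : ∀ {i j} → j ≤ i → j ≼ i
      ≤⇒≼ {i} {j} j≤i = A.nonempty i , _ ,
        θ.reflexive (≈ᴾ-p (x≤x∨y i j) (∨-least I.refl j≤i))

      ≼-trans : ∀ {i j k} → k ≼ j → j ≼ i → k ≼ i
      ≼-trans {i} {j} {k} (_ , _ , s) j≼i = x , _ , θ.trans xθm (θ.sym qθm)
        where
        x = A.nonempty i
        -- This is the join met when `x`, already moved to `i ∨ j`, is combined with the pair from
        -- `j` to `j ∨ k`.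
        m = (i ∨ j) ∨ (j ∨ k)
        i≤m : i ≤ m
        i≤m = I.trans (x≤x∨y i j) (x≤x∨y _ _)
        ik≤m : i ∨ k ≤ m
        ik≤m = ∨-least i≤m (I.trans (y≤x∨y j k) (y≤x∨y _ _))
        xθm : θ (i , x) (m , p (x≤x∨y _ _) (p (x≤x∨y i j) x))
        xθm = θ.trans (≼-absorb j≼i x)
          (θ.trans (θ.reflexive (≈ᴾ-p I.refl I.refl))
            (p-compatible θ.refl s I.refl (y≤x∨y i j) (x≤x∨y _ _)
              (x≤x∨y _ _) (y≤x∨y _ _) I.refl))
        qθm : θ (i ∨ k , p (x≤x∨y i k) x) (m , p (x≤x∨y _ _) (p (x≤x∨y i j) x))
        -- Joining both sides of `xθm` with index `k` moves `x` to `i ∨ k` and leaves its image at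
        -- `m`, since `k ≤ m`.
        qθm = θ.trans
          (p-compatible xθm (θ.refl {k , A.nonempty k})
            (x≤x∨y i k) (y≤x∨y i k) I.refl
            I.refl (I.trans (y≤x∨y i k) ik≤m) (x≤x∨y _ _))
          (θ.reflexive (P.≈-sym (≈ᴾ-p I.refl I.refl)))

      -- Applying `f` to the two witnesses stays at `i` on the left and lands at
      -- `(i ∨ j) ∨ (i ∨ k)`, that is `i ∨ (j ∨ k)`, on the right.
      ∨-≼ : ∀ {i j k} → j ≼ i → k ≼ i → j ∨ k ≼ i
      ∨-≼ {i} {j} {k} (x , _ , s) (_ , _ , t) = _ , _ ,
        p-compatible s t
          I.refl I.refl (x≤x∨y _ _)
          (∨-least (x≤x∨y _ _) (I.trans (x≤x∨y j k) (y≤x∨y _ _)))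
          (∨-least (x≤x∨y _ _) (I.trans (y≤x∨y j k) (y≤x∨y _ _)))
          (∨-least (I.trans (x≤x∨y i j) (x≤x∨y _ _))
            (∨-least (I.trans (y≤x∨y i j) (x≤x∨y _ _)) (I.trans (y≤x∨y i k) (y≤x∨y _ _))))

      C⇒≽ : ∀ {i j} → C 𝔸 θ i j → j ≼ i
      C⇒≽ = proj₁

      C⇒≼ : ∀ {i j} → C 𝔸 θ i j → i ≼ j
      C⇒≼ {i} {j} (_ , x , y , s) = x , _ ,
        -- `C` records the join as `i ∨ j`, while `i ≼ j` asks for `j ∨ i`.
        S-absorb (x , y , s) (x≤x∨y j i)
          (∨-least (y≤x∨y _ _) (x≤x∨y _ _))
          (∨-least (x≤x∨y _ _) (I.trans (x≤x∨y i j) (y≤x∨y _ _))) x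

      ≼-antisym : ∀ {i j} → j ≼ i → i ≼ j → C 𝔸 θ i j
      ≼-antisym {i} {j} j≼i (x , y , s) = j≼i , x , _ ,
        S-absorb (x , y , s) (y≤x∨y i j)
          (∨-least (y≤x∨y _ _) (x≤x∨y _ _))
          (∨-least (I.trans (y≤x∨y j i) (y≤x∨y _ _)) (x≤x∨y _ _)) x

      S⇒C : ∀ {i j} → S 𝔸 θ i j → C 𝔸 θ i j
      S⇒C s@(x , y , xθy) = ≼-antisym (S⇒≼ s) (S⇒≼ (y , x , θ.sym xθy))

      -- `C θ` is the symmetric part of a preorder in which joins of indices remain least upper
      -- bounds.
      C-isCongruence : IsCongruence indexAlgebra (C 𝔸 θ)
      C-isCongruence = record
        { reflexive     = λ i≈j →
            ≼-antisym (≤⇒≼ (I.reflexive (I.Eq.sym i≈j))) (≤⇒≼ (I.reflexive i≈j))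
        ; isEquivalence = record
          { refl  = ≼-antisym (≤⇒≼ I.refl) (≤⇒≼ I.refl)
          ; sym   = λ q → ≼-antisym (C⇒≼ q) (C⇒≽ q)
          ; trans = λ q q′ → ≼-antisym (≼-trans (C⇒≽ q′) (C⇒≽ q)) (≼-trans (C⇒≼ q) (C⇒≼ q′))
          }
        ; compatible    = λ _ q → ≼-antisym
            (∨-≼ (≼-trans (C⇒≽ (q zero)) (≤⇒≼ (x≤x∨y _ _)))
                 (≼-trans (C⇒≽ (q (suc zero))) (≤⇒≼ (y≤x∨y _ _))))
            (∨-≼ (≼-trans (C⇒≼ (q zero)) (≤⇒≼ (x≤x∨y _ _)))
                 (≼-trans (C⇒≼ (q (suc zero))) (≤⇒≼ (y≤x∨y _ _))))
        }

      Restrict-isCongruence : ∀ i → IsCongruence (algebra i) (Restrict 𝔸 θ i i)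
      Restrict-isCongruence i = record
        { reflexive     = λ e → θ.reflexive
            (≈ᴾ-intro I.refl I.refl (A.≈-trans i (p-id _ _) e))
        ; isEquivalence = record { refl = θ.refl ; sym = θ.sym ; trans = θ.trans }
        ; compatible    = λ g {xs} {ys} q →
            θ.trans (θ.reflexive (P.≈-sym (p-opᴾ g xs)))
              (θ.trans
                -- A nullary operation of the sum takes its value at the least index; combining with
                -- an element of index `i` brings every case to `i`.
                (p-compatible (θ.compatible g q) (θ.refl {i , A.nonempty i})
                  (bound g xs) I.refl (y≤x∨y _ _) (bound g ys) I.refl (y≤x∨y _ _))
                (θ.reflexive (p-opᴾ g ys)))
        }
        where
        bound : ∀ g (xs : Vector (A.Carrier i) (arity Ω g)) →
                outputIndex 𝔸 g (λ k → i , xs k) ≤ i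
        bound g xs = ⟦⟧-index-≤ {ρ = λ k → i , xs k} (λ _ → I.refl) (node g var)

        p-opᴾ : ∀ g (xs : Vector (A.Carrier i) (arity Ω g)) →
          (i , p (bound g xs) (proj₂ (opᴾ 𝔸 g (λ k → i , xs k)))) P.≈ (i , A.op i g xs)
        p-opᴾ g xs = ≈ᴾ-intro I.refl I.refl (A.≈-trans i (p-id _ _)
          (A.≈-trans i (p-⟦⟧ {ρ = λ k → i , xs k} (λ _ → I.refl) (node g var) _)
            (A.op-cong i g (λ k → p-id _ _))))

    -- From the sum to the indices and the components.

    module _ {θ₁ : Rel (PłonkaCarrier 𝔸) r₁} {θ₂ : Rel (PłonkaCarrier 𝔸) r₂}
             (θ₁-cong : IsCongruence P θ₁) (θ₂-cong : IsCongruence P θ₂) where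
      private
        module θ₁ = CongruenceLaws θ₁-cong
        module θ₂ = CongruenceLaws θ₂-cong

      module _ (θ₁∩θ₂⇒≈ : ∀ {x y} → θ₁ x y → θ₂ x y → x P.≈ y) where

        -- An element of index `i` is related by both congruences to its image at `i ∨ j`, hence
        -- equals it, which forces `i` and `i ∨ j` to coincide.
        S∩S⇒≥ : ∀ {i j} → S 𝔸 θ₁ i j → S 𝔸 θ₂ i j → j ≤ i
        S∩S⇒≥ {i} {j} s t = I.trans (y≤x∨y i j) (I.reflexive (I.Eq.sym (proj₁ x≈px)))
          where
          x≈px : (i , A.nonempty i) P.≈ (i ∨ j , p (x≤x∨y i j) (A.nonempty i))
          x≈px = θ₁∩θ₂⇒≈ (S-absorb θ₁-cong s _ (y≤x∨y _ _) I.refl _)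
                         (S-absorb θ₂-cong t _ (y≤x∨y _ _) I.refl _)

        C∩C⇒≈ : ∀ {i j} → C 𝔸 θ₁ i j → C 𝔸 θ₂ i j → i I.≈ j
        C∩C⇒≈ {i} {j} (s , s′) (t , t′) = I.antisym
          (I.trans (x≤x∨y i j) (S∩S⇒≥ s′ t′))
          (I.trans (y≤x∨y i j) (S∩S⇒≥ s t))

        -- The indices of x and z are related by both S θ₁ and S θ₂, so z may be
        -- moved into the component of x and y.
        Restrict-composition : ∀ {i x y} → (θ₁ ; θ₂) (i , x) (i , y) →
                     (Restrict 𝔸 θ₁ i i ; Restrict 𝔸 θ₂ i i) x y
        Restrict-composition {i} {x} {y} ((j , z) , xθ₁z , zθ₂y) =
          p j≤i z , θ₁.trans xθ₁z (θ₁.reflexive z≈pz)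
                  , θ₂.trans (θ₂.reflexive (P.≈-sym z≈pz)) zθ₂y
          where
          s₁ : S 𝔸 θ₁ i j
          s₁ = x , z , xθ₁z
          s₂ : S 𝔸 θ₂ i j
          s₂ = y , z , θ₂.sym zθ₂y
          j≤i : j ≤ i
          j≤i = S∩S⇒≥ s₁ s₂
          i≤j : i ≤ j
          i≤j = S∩S⇒≥ (z , x , θ₁.sym xθ₁z) (z , y , zθ₂y)
          z≈pz : (j , z) P.≈ (i , p j≤i z)
          z≈pz = ≈ᴾ-p j≤i i≤j

      C-composition : (∀ x y → (θ₁ ; θ₂) x y) → ∀ i j → (C 𝔸 θ₁ ; C 𝔸 θ₂) i j
      C-composition total i j =
        let (k , z) , xθ₁z , zθ₂y = total (i , A.nonempty i) (j , A.nonempty j)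
        in k , S⇒C θ₁-cong (_ , _ , xθ₁z) , S⇒C θ₂-cong (_ , _ , zθ₂y)

      -- From the indices and the components back to the sum.

      module _ (C-pair : IsFactorPair indexAlgebra (C 𝔸 θ₁) (C 𝔸 θ₂))
               (restrict-pair : ∀ i → IsFactorPair (algebra i) (Restrict 𝔸 θ₁ i i) (Restrict 𝔸 θ₂ i i))
               where

        -- Triviality of the meet on indices gives equal indices; after moving `x` along `p`,
        -- triviality of the meet in one component finishes.
        ∩⇒≈ : ∀ {x y} → θ₁ x y → θ₂ x y → x P.≈ y
        ∩⇒≈ {i , x} {j , y} xθ₁y xθ₂y = ≈ᴾ-intro i≤j j≤i
          (proj₁ (IsFactorPair.meet (restrict-pair j))
            ( θ₁.trans (θ₁.reflexive (P.≈-sym x≈px)) xθ₁y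
            , θ₂.trans (θ₂.reflexive (P.≈-sym x≈px)) xθ₂y ))
          where
          i≈j : i I.≈ j
          i≈j = proj₁ (IsFactorPair.meet C-pair)
                  (S⇒C θ₁-cong (_ , _ , xθ₁y) , S⇒C θ₂-cong (_ , _ , xθ₂y))
          i≤j = I.reflexive i≈j
          j≤i = I.reflexive (I.Eq.sym i≈j)
          x≈px : (i , x) P.≈ (j , p i≤j x)
          x≈px = ≈ᴾ-p i≤j j≤i

        same-index-Join : ∀ i x y → Join P θ₁ θ₂ (i , x) (i , y)
        same-index-Join i x y =
          let _ , xθ₁z , zθ₂y = IsFactorPair⇒universal (restrict-pair i) x y
          in transitive (base (inj₁ xθ₁z)) (base (inj₂ zθ₂y))

        -- The path goes up from `i` to `i ∨ j` and down to `j` along the two `θ₁` witnesses; gaps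
        -- inside a component are bridged by its own factor pair.
        C₁⇒Join : ∀ {i j} → C 𝔸 θ₁ i j → ∀ x y → Join P θ₁ θ₂ (i , x) (j , y)
        C₁⇒Join {i} {j} ((u , v , s) , (w , z , t)) x y =
          transitive (same-index-Join i x u)
            (transitive (base (inj₁ s))
              (transitive (same-index-Join (i ∨ j) v z)
                (transitive (base (inj₁ (θ₁.sym t)))
                  (same-index-Join j w y))))

        C₂⇒Join : ∀ {i j} → C 𝔸 θ₂ i j → ∀ x y → Join P θ₁ θ₂ (i , x) (j , y)
        C₂⇒Join {i} {j} ((u , v , s) , (w , z , t)) x y =
          transitive (same-index-Join i x u)
            (transitive (base (inj₂ s))
              (transitive (same-index-Join (i ∨ j) v z)
                (transitive (base (inj₂ (θ₂.sym t)))
                  (same-index-Join j w y))))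

        Join-universal : Universal (Join P θ₁ θ₂)
        Join-universal (i , x) (j , y) =
          let k , iC₁k , kC₂j = IsFactorPair⇒universal C-pair i j
          in transitive (C₁⇒Join iC₁k x (A.nonempty k)) (C₂⇒Join kC₂j (A.nonempty k) y)

theorem12 : ∀ {o e c ℓ₁ ℓ₂ a ℓ r₁ r₂} (Ω : Signature o) → Plural Ω →
    (𝒱 : Variety Ω e) → StronglyIrregular 𝒱 a ℓ →
    (𝔸 : DirectSystem Ω c ℓ₁ ℓ₂ a ℓ) → (∀ i → DirectSystem.algebra 𝔸 i ∈ 𝒱) →
    (θ₁ : Rel (PłonkaCarrier 𝔸) r₁) → IsCongruence (PłonkaSum 𝔸) θ₁ →
    (θ₂ : Rel (PłonkaCarrier 𝔸) r₂) → IsCongruence (PłonkaSum 𝔸) θ₂ →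
    IsFactorPair (PłonkaSum 𝔸) θ₁ θ₂
    ⇔
    ( Permutable (PłonkaSum 𝔸) θ₁ θ₂
    × IsFactorPair (DirectSystem.indexAlgebra 𝔸) (C 𝔸 θ₁) (C 𝔸 θ₂)
    × (∀ i → IsFactorPair (DirectSystem.algebra 𝔸 i) (Restrict 𝔸 θ₁ i i) (Restrict 𝔸 θ₂ i i)) )
theorem12 Ω _ 𝒱 (f , f∋0 , f∋1 , f-valid) 𝔸 A∈𝒱 θ₁ θ₁-cong θ₂ θ₂-cong = mk⇔
  (λ pair →
    let meet⇒≈ = λ {x} {y} xθ₁y xθ₂y → proj₁ (IsFactorPair.meet pair) {x} {y} (xθ₁y , xθ₂y)
        total₁ = IsFactorPair⇒universal pair
        total₂ = IsFactorPair⇒universal˘ pair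
    in IsFactorPair.permutable pair
     , universal⇒IsFactorPair
         (C-isCongruence 𝔸 f f∋0 f∋1 f≈0 θ₁-cong)
         (C-isCongruence 𝔸 f f∋0 f∋1 f≈0 θ₂-cong)
         (C∩C⇒≈ 𝔸 f f∋0 f∋1 f≈0 θ₁-cong θ₂-cong meet⇒≈)
         (C-composition 𝔸 f f∋0 f∋1 f≈0 θ₁-cong θ₂-cong total₁)
         -- Exchanging the two congruences gives totality of the opposite composite.
         (C-composition 𝔸 f f∋0 f∋1 f≈0 θ₂-cong θ₁-cong total₂)
     , λ i → universal⇒IsFactorPair
         (Restrict-isCongruence 𝔸 f f∋0 f∋1 f≈0 θ₁-cong i)
         (Restrict-isCongruence 𝔸 f f∋0 f∋1 f≈0 θ₂-cong i)
         (λ xθ₁y xθ₂y → ≈ᴾ⇒≈ 𝔸 (meet⇒≈ xθ₁y xθ₂y))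
         (λ x y → Restrict-composition 𝔸 f f∋0 f∋1 f≈0 θ₁-cong θ₂-cong meet⇒≈ (total₁ _ _))
         (λ x y → Restrict-composition 𝔸 f f∋0 f∋1 f≈0 θ₂-cong θ₁-cong
           (λ xθ₂y xθ₁y → meet⇒≈ xθ₁y xθ₂y) (total₂ _ _)))
  (λ (permutable , C-pair , restrict-pair) → record
    { isCongruence₁ = θ₁-cong
    ; isCongruence₂ = θ₂-cong
    ; meet          =
        (λ (xθ₁y , xθ₂y) → ∩⇒≈ 𝔸 f f∋0 f∋1 f≈0 θ₁-cong θ₂-cong
          C-pair restrict-pair xθ₁y xθ₂y)
      , λ x≈y → IsCongruence.reflexive θ₁-cong x≈y , IsCongruence.reflexive θ₂-cong x≈y
    ; join          = Join-universal 𝔸 f f∋0 f∋1 f≈0 θ₁-cong θ₂-cong C-pair restrict-pair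
    ; permutable    = permutable
    })
  where
  f≈0 : ∀ i → Satisfies (DirectSystem.algebra 𝔸 i) f (var zero)
  f≈0 i = f-valid (DirectSystem.algebra 𝔸 i) (A∈𝒱 i)
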